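{- Let $G$ be a polygonal thin square grid graph and let $C$ be a cycle of pixels of $G$. Then there is a pixel $p\in C$ such that exactly two pixels of $G$ are adjacent to $p$ and these two pixels lie on opposite sides of $p$.
   Context: A square grid graph is a finite graph $G=(V,E)$ with $V\subset\mathbb{Z}^2$ and $E$ the set of all pairs of vertices at Euclidean distance $1$. In the natural plane embedding, the unbounded face is bounded by the outer boundary; a bounded face containing a lattice point in its interior is a hole, bounded by an inner boundary; every other bounded face is a pixel (a unit square bounded by a $4$-cycle of $G$). A boundary vertex is one on the outer or an inner boundary. $G$ is polygonal if every vertex and edge lies on some pixel and no vertex can be removed so as to merge two boundaries (the boundaries pairwise share no vertex). $G$ is thin if every vertex is a boundary vertex. Two pixels are adjacent if they share an edge. A cycle of pixels is a set of $k\ge 3$ distinct pixels of $G$ that can be ordered cyclically $p_1,\dots,p_k$ with $p_i$ adjacent to $p_{i+1}$ for all $i$ (indices mod $k$). Two pixels adjacent to $p$ lie on opposite sides of $p$ if they share the left and right edges of $p$, respectively, or the top and bottom edges of $p$. -}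

module Defs where

open import Data.Integer using (ℤ; 0ℤ; 1ℤ; -1ℤ; _+_)
open import Data.Product using (_×_; _,_; Σ; ∃)
open import Data.Sum using (_⊎_)
open import Data.Nat using (_≥_)
open import Data.List using (List; length; take; _++_)
open import Data.List.Membership.Propositional using (_∈_)
open import Data.List.Relation.Unary.All using (All)
open import Data.List.Relation.Unary.Unique.Propositional using (Unique)
open import Data.List.Relation.Unary.Linked using (Linked)
open import Relation.Binary.PropositionalEquality using (_≡_; _≢_)
open import Relation.Nullary using (¬_)

Point : Set
Point = ℤ × ℤ

_⊕_ : Point → Point → Point
(a , b) ⊕ (c , d) = (a + c , b + d)

infixl 6 _⊕_

east west north south : Point
east  = (1ℤ , 0ℤ)
west  = (-1ℤ , 0ℤ)
north = (0ℤ , 1ℤ)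
south = (0ℤ , -1ℤ)

UnitStep : Point → Point → Set
UnitStep p q = q ≡ p ⊕ east ⊎ q ≡ p ⊕ west ⊎ q ≡ p ⊕ north ⊎ q ≡ p ⊕ south

-- A square grid graph is given by its finite vertex set V ⊂ ℤ² (a list);
-- its edges are all pairs of vertices at distance 1 (UnitStep).
GridGraph : Set
GridGraph = List Point

-- The unit square with lower-left corner p.  It is a pixel of G iff all
-- four corners are vertices of G (its four sides are then edges, and it is
-- a bounded face since no vertex/edge lies in its interior).
-- Pixels are identified with their lower-left corners.
IsPixel : GridGraph → Point → Set
IsPixel V p = p ∈ V × (p ⊕ east) ∈ V × (p ⊕ north) ∈ V × (p ⊕ east ⊕ north) ∈ V

CornerOf : Point → Point → Set
CornerOf v p = v ≡ p ⊎ v ≡ p ⊕ east ⊎ v ≡ p ⊕ north ⊎ v ≡ p ⊕ east ⊕ north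

-- Two pixels are adjacent iff they share an edge, i.e. their lower-left
-- corners differ by a unit vector.
AdjacentPixels : GridGraph → Point → Point → Set
AdjacentPixels V p q = IsPixel V p × IsPixel V q × UnitStep p q

NE NW SW SE : Point → Point
NE v = v
NW v = v ⊕ west
SW v = v ⊕ west ⊕ south
SE v = v ⊕ south

-- Boundary vertex: v lies on the outer boundary or on an inner boundary,
-- i.e. v is incident to a face that is not a pixel, i.e. one of the four
-- unit squares around v is not a pixel.
BoundaryVertex : GridGraph → Point → Set
BoundaryVertex V v =
  ¬ IsPixel V (NE v) ⊎ ¬ IsPixel V (NW v) ⊎ ¬ IsPixel V (SW v) ⊎ ¬ IsPixel V (SE v)

-- Polygonal:
--  (1) every vertex lies on some pixel;
--  (2) every edge lies on some pixel (both endpoints are corners of it);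
--  (3) boundaries pairwise share no vertex: no vertex has a "pinch", i.e.
--      two diagonally opposite incident squares are pixels while the other
--      two are not (this is exactly the local configuration where two
--      distinct boundaries meet at v, given (1) and (2)).
record Polygonal (V : GridGraph) : Set where
  field
    vertexOnPixel : ∀ v → v ∈ V → Σ Point λ p → IsPixel V p × CornerOf v p
    edgeOnPixel   : ∀ u w → u ∈ V → w ∈ V → UnitStep u w →
                    Σ Point λ p → IsPixel V p × CornerOf u p × CornerOf w p
    noPinch₁      : ∀ v → ¬ (IsPixel V (NE v) × IsPixel V (SW v) ×
                             ¬ IsPixel V (NW v) × ¬ IsPixel V (SE v))
    noPinch₂      : ∀ v → ¬ (IsPixel V (NW v) × IsPixel V (SE v) ×
                             ¬ IsPixel V (NE v) × ¬ IsPixel V (SW v))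

Thin : GridGraph → Set
Thin V = ∀ v → v ∈ V → BoundaryVertex V v

-- A cycle of pixels: k ≥ 3 distinct pixels p₁ … p_k (a list) with p_i
-- adjacent to p_{i+1} for all i, indices mod k (so also p_k adjacent to p₁).
record PixelCycle (V : GridGraph) (C : List Point) : Set where
  field
    atLeast3 : length C ≥ 3
    pixels   : All (IsPixel V) C
    distinct : Unique C
    cyclic   : Linked (AdjacentPixels V) (C ++ take 1 C)

OppositeSides : Point → Point → Point → Set
OppositeSides p q r =
  (q ≡ p ⊕ west × r ≡ p ⊕ east) ⊎ (q ≡ p ⊕ east × r ≡ p ⊕ west) ⊎
  (q ≡ p ⊕ south × r ≡ p ⊕ north) ⊎ (q ≡ p ⊕ north × r ≡ p ⊕ south)

ExactlyTwoOppositeNeighbours : GridGraph → Point → Set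
ExactlyTwoOppositeNeighbours V p =
  Σ Point λ q → Σ Point λ r →
    q ≢ r × AdjacentPixels V p q × AdjacentPixels V p r ×
    (∀ s → AdjacentPixels V p s → s ≡ q ⊎ s ≡ r) ×
    OppositeSides p q r

-- Let m be the highest pixel of the cycle, the rightmost one if there are several.  The pixels east of,
-- north of, and north-west of m are higher than m, so they are not on the cycle, and the two cycle
-- neighbours of m are its west and south neighbours w and s.  By thinness the vertex m is not surrounded
-- by pixels, so the square sw south of w is not a pixel; hence the second cycle neighbour of w is its
-- west neighbour x.  If the square above w is not a pixel, w is adjacent exactly to x and m.  Otherwise
-- thinness at the top-left corner of w rules out the square above x, and the square below x is ruled out
-- because a square flanked on the west and east by pixels is a pixel, which would make sw one; then the
-- second cycle neighbour of x is its west neighbour, and x is adjacent exactly to it and w.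
module Submission where

open import Defs
open import Level using (_⊔_)
open import Data.Integer as ℤ using (ℤ; 0ℤ; 1ℤ; +<+)
import Data.Integer.Properties as ℤ
open import Data.Nat using (s≤s; z≤n; _≥_)
open import Data.Product using (_×_; _,_; Σ; ∃; ∃₂; proj₁; proj₂)
open import Data.Product.Properties using (≡-dec)
open import Data.Product.Relation.Binary.Lex.NonStrict using (×-totalOrder)
open import Data.Sum using (_⊎_; inj₁; inj₂) renaming (swap to ⊎-swap)
open import Data.Empty using (⊥-elim)
open import Data.List using (List; []; _∷_; _++_; _∷ʳ_; [_]; length; take; foldl; foldr; initLast; _∷ʳ′_)
open import Data.List.Properties using (++-assoc; ++-identityʳ)
open import Data.List.Membership.Propositional using (_∈_; _∉_)
open import Data.List.Membership.Propositional.Properties using (∈-∃++; ∈-++⁺ʳ)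
open import Data.List.Relation.Unary.Any using (here; there)
import Data.List.Relation.Unary.All as All
open import Data.List.Relation.Unary.AllPairs using ([]; _∷_)
open import Data.List.Relation.Unary.Linked using (Linked; [-]; _∷_; head; tail)
open import Data.List.Relation.Unary.Unique.Propositional using (Unique)
import Data.List.Relation.Unary.Unique.Propositional.Properties as Unique
open import Data.List.Relation.Binary.Permutation.Propositional.Properties using (∈-resp-↭; ↭-length; ++-comm; ∷↭∷ʳ)
open import Relation.Binary using (Rel; Symmetric; TotalOrder)
open import Relation.Binary.PropositionalEquality using (_≡_; _≢_; refl; sym; trans; cong; cong₂; subst)
open import Relation.Nullary using (¬_; Dec; yes; no)
open import Relation.Nullary.Decidable using (_×-dec_)
open import Function using (_∘_)

record Cycle {a ℓ} {A : Set a} (R : Rel A ℓ) (xs : List A) : Set (a ⊔ ℓ) where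
  field
    atLeast3 : length xs ≥ 3
    unique   : Unique xs
    closed   : Linked R (xs ++ take 1 xs)

module _ {a ℓ} {A : Set a} {R : Rel A ℓ} where

  Linked-∷ʳ⁺ : ∀ {xs y z} → Linked R (xs ∷ʳ y) → R y z → Linked R (xs ∷ʳ y ∷ʳ z)
  Linked-∷ʳ⁺ {[]}         _       s = s ∷ [-]
  Linked-∷ʳ⁺ {w ∷ []}     (r ∷ _) s = r ∷ s ∷ [-]
  Linked-∷ʳ⁺ {w ∷ v ∷ vs} (r ∷ l) s = r ∷ Linked-∷ʳ⁺ {v ∷ vs} l s

  Linked-last : ∀ {xs y z} → Linked R (xs ∷ʳ y ∷ʳ z) → R y z
  Linked-last {[]}     (r ∷ _) = r
  Linked-last {w ∷ xs} l       = Linked-last {xs} (tail l)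

  Unique-rotate : ∀ {x : A} {xs} → Unique (x ∷ xs) → Unique (xs ∷ʳ x)
  Unique-rotate (x∉xs ∷ u) = Unique.++⁺ u (All.[] ∷ []) λ { (v∈xs , here refl) → All.lookup x∉xs v∈xs refl }

  Cycle-rotate : ∀ {x xs} → Cycle R (x ∷ xs) → Cycle R (xs ∷ʳ x)
  Cycle-rotate {x} {xs} c = record
    { atLeast3 = subst (_≥ 3) (↭-length (∷↭∷ʳ x xs)) atLeast3
    ; unique   = Unique-rotate unique
    ; closed   = closed-rotate xs closed
    }
    where
    open Cycle c
    closed-rotate : ∀ xs → Linked R (x ∷ xs ∷ʳ x) → Linked R ((xs ∷ʳ x) ++ take 1 (xs ∷ʳ x))
    closed-rotate []       l = l
    closed-rotate (y ∷ ys) l = Linked-∷ʳ⁺ {y ∷ ys} (tail l) (head l)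

  Cycle-rotateBy : ∀ as {bs} → Cycle R (as ++ bs) → Cycle R (bs ++ as)
  Cycle-rotateBy []       {bs} c = subst (Cycle R) (sym (++-identityʳ bs)) c
  Cycle-rotateBy (a ∷ as) {bs} c =
    subst (Cycle R) (++-assoc bs [ a ] as)
      (Cycle-rotateBy as (subst (Cycle R) (++-assoc as bs [ a ]) (Cycle-rotate c)))

  module _ (R-sym : Symmetric R) where

    TwoNeighboursIn : List A → A → Set (a ⊔ ℓ)
    TwoNeighboursIn xs x = ∃₂ λ y z → y ∈ xs × z ∈ xs × y ≢ z × R x y × R x z

    Cycle-head-neighbours : ∀ {x xs} → Cycle R (x ∷ xs) → TwoNeighboursIn xs x
    Cycle-head-neighbours {xs = []}     record { atLeast3 = s≤s () }
    Cycle-head-neighbours {xs = y ∷ zs} c with initLast zs | Cycle.atLeast3 c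
    ... | []        | s≤s (s≤s ())
    ... | zs₀ ∷ʳ′ l | _ =
      y , l , here refl , there (∈-++⁺ʳ zs₀ (here refl)) , y≢l , head closed ,
      R-sym (Linked-last {_ ∷ y ∷ zs₀} closed)
      where
      open Cycle c
      y≢l : y ≢ l
      y≢l with unique
      ... | _ ∷ y∉zs ∷ _ = All.lookup y∉zs (∈-++⁺ʳ zs₀ (here refl))

    Cycle-neighbours : ∀ {xs x} → Cycle R xs → x ∈ xs → TwoNeighboursIn xs x
    Cycle-neighbours c x∈xs with ∈-∃++ x∈xs
    ... | as , bs , refl with Cycle-head-neighbours (Cycle-rotateBy as c)
    ... | y , z , y∈ , z∈ , y≢z , r , s = y , z , unrotate y∈ , unrotate z∈ , y≢z , r , s
      where
      unrotate : ∀ {v} → v ∈ bs ++ as → v ∈ as ++ _ ∷ bs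
      unrotate v∈ = ∈-resp-↭ (++-comm (_ ∷ bs) as) (there v∈)

    -- x has two distinct neighbours on the cycle, and they cannot both be a.
    Cycle-neighbour-forced : ∀ {xs x a b} → Cycle R xs → x ∈ xs →
                             (∀ {z} → z ∈ xs → R x z → z ≡ a ⊎ z ≡ b) → b ∈ xs × R x b
    Cycle-neighbour-forced c x∈xs only with Cycle-neighbours c x∈xs
    ... | y , z , y∈ , z∈ , y≢z , r , s with only y∈ r | only z∈ s
    ... | inj₂ refl | _         = y∈ , r
    ... | _         | inj₂ refl = z∈ , s
    ... | inj₁ refl | inj₁ refl = ⊥-elim (y≢z refl)

origin : Point
origin = (0ℤ , 0ℤ)

walk : Point → List Point → Point
walk = foldl _⊕_

displacement : List Point → Point
displacement = foldr _⊕_ origin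

⊕-assoc : ∀ p u w → p ⊕ u ⊕ w ≡ p ⊕ (u ⊕ w)
⊕-assoc (a , b) (c , d) (e , f) = cong₂ _,_ (ℤ.+-assoc a c e) (ℤ.+-assoc b d f)

⊕-identityʳ : ∀ p → p ⊕ origin ≡ p
⊕-identityʳ (a , b) = cong₂ _,_ (ℤ.+-identityʳ a) (ℤ.+-identityʳ b)

walk-displacement : ∀ p us → walk p us ≡ p ⊕ displacement us
walk-displacement p []       = sym (⊕-identityʳ p)
walk-displacement p (u ∷ us) = trans (walk-displacement (p ⊕ u) us) (⊕-assoc p u (displacement us))

-- As _⊕_ is left-associative, p ⊕ u₁ ⊕ ⋯ ⊕ uₙ is definitionally walk p (u₁ ∷ ⋯ ∷ uₙ ∷ []), and the
-- displacement of a list of unit vectors normalises to a literal; so reroute p us ws refl proves any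
-- identity between two such expressions.
reroute : ∀ p us ws → displacement us ≡ displacement ws → walk p us ≡ walk p ws
reroute p us ws d = trans (walk-displacement p us) (trans (cong (p ⊕_) d) (sym (walk-displacement p ws)))

i<i+1 : ∀ i → i ℤ.< i ℤ.+ 1ℤ
i<i+1 i = subst (ℤ._< i ℤ.+ 1ℤ) (ℤ.+-identityʳ i) (ℤ.+-monoʳ-< i (+<+ (s≤s z≤n)))

west≢east : ∀ p → p ⊕ west ≢ p ⊕ east
west≢east (a , b) e = ℤ.<-irrefl (cong proj₁ e) (ℤ.+-monoʳ-< a (ℤ.-<+ {0} {1}))

UnitStep-sym : ∀ {p q} → UnitStep p q → UnitStep q p
UnitStep-sym {p} (inj₁ refl)                = inj₂ (inj₁ (reroute p [] (east ∷ west ∷ []) refl))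
UnitStep-sym {p} (inj₂ (inj₁ refl))         = inj₁ (reroute p [] (west ∷ east ∷ []) refl)
UnitStep-sym {p} (inj₂ (inj₂ (inj₁ refl))) = inj₂ (inj₂ (inj₂ (reroute p [] (north ∷ south ∷ []) refl)))
UnitStep-sym {p} (inj₂ (inj₂ (inj₂ refl))) = inj₂ (inj₂ (inj₁ (reroute p [] (south ∷ north ∷ []) refl)))

module _ {V : GridGraph} where

  AdjacentPixels-sym : Symmetric (AdjacentPixels V)
  AdjacentPixels-sym (pixel-p , pixel-q , step) = pixel-q , pixel-p , UnitStep-sym step

  adjacent-pixel : ∀ {p q} → AdjacentPixels V p q → IsPixel V q
  adjacent-pixel = proj₁ ∘ proj₂

  IsPixel-reroute : ∀ p us ws → displacement us ≡ displacement ws → IsPixel V (walk p us) → IsPixel V (walk p ws)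
  IsPixel-reroute p us ws d = subst (IsPixel V) (reroute p us ws d)

  isPixel? : ∀ q → Dec (IsPixel V q)
  isPixel? q = (q ∈? V) ×-dec ((q ⊕ east) ∈? V) ×-dec ((q ⊕ north) ∈? V) ×-dec ((q ⊕ east ⊕ north) ∈? V)
    where open import Data.List.Membership.DecPropositional (≡-dec ℤ._≟_ ℤ._≟_) using (_∈?_)

  -- The west and east neighbours of q together contain all four corners of q.
  pixel-between : ∀ {q} → IsPixel V (q ⊕ west) → IsPixel V (q ⊕ east) → IsPixel V q
  pixel-between {q} (_ , q∈ , _ , q⊕north∈) (q⊕east∈ , _ , q⊕east⊕north∈ , _) =
    subst (_∈ V) (reroute q (west ∷ east ∷ []) [] refl) q∈ ,
    q⊕east∈ ,
    subst (_∈ V) (reroute q (west ∷ east ∷ north ∷ []) (north ∷ []) refl) q⊕north∈ ,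
    q⊕east⊕north∈

  thin⇒unsurrounded : Thin V → ∀ v → IsPixel V (NE v) → IsPixel V (NW v) → IsPixel V (SW v) →
                      ¬ IsPixel V (SE v)
  thin⇒unsurrounded thin v ne nw sw se with thin v (proj₁ ne)
  ... | inj₁ ¬ne               = ¬ne ne
  ... | inj₂ (inj₁ ¬nw)        = ¬nw nw
  ... | inj₂ (inj₂ (inj₁ ¬sw)) = ¬sw sw
  ... | inj₂ (inj₂ (inj₂ ¬se)) = ¬se se

  horizontal-neighbours : ∀ {p q} → ¬ IsPixel V (p ⊕ north) → ¬ IsPixel V (p ⊕ south) →
                          AdjacentPixels V p q → q ≡ p ⊕ west ⊎ q ≡ p ⊕ east
  horizontal-neighbours ¬N ¬S (_ , _ , inj₁ e)                      = inj₂ e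
  horizontal-neighbours ¬N ¬S (_ , _ , inj₂ (inj₁ e))               = inj₁ e
  horizontal-neighbours ¬N ¬S (_ , pixel-q , inj₂ (inj₂ (inj₁ refl))) = ⊥-elim (¬N pixel-q)
  horizontal-neighbours ¬N ¬S (_ , pixel-q , inj₂ (inj₂ (inj₂ refl))) = ⊥-elim (¬S pixel-q)

  exactlyTwoOpposite-horizontal : ∀ {p} → IsPixel V p → IsPixel V (p ⊕ west) → IsPixel V (p ⊕ east) →
                                  ¬ IsPixel V (p ⊕ north) → ¬ IsPixel V (p ⊕ south) →
                                  ExactlyTwoOppositeNeighbours V p
  exactlyTwoOpposite-horizontal {p} pixel-p pixel-w pixel-e ¬N ¬S =
    p ⊕ west , p ⊕ east , west≢east p ,
    (pixel-p , pixel-w , inj₂ (inj₁ refl)) , (pixel-p , pixel-e , inj₁ refl) ,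
    (λ _ → horizontal-neighbours ¬N ¬S) , inj₁ (refl , refl)

heightOrder : TotalOrder _ _ _
heightOrder = ×-totalOrder ℤ.≤-decTotalOrder ℤ.≤-totalOrder

open TotalOrder heightOrder using () renaming (_≤_ to _≤ₕ_)
open import Data.List.Extrema heightOrder using (argmax; argmax-sel; f[⊥]≤f[argmax]; f[xs]≤f[argmax])

-- heightOrder is lexicographic, so points are compared by row first and by column second.
height : Point → ℤ × ℤ
height (x , y) = (y , x)

highest : ∀ c cs → ∃ λ m → m ∈ c ∷ cs × (∀ {q} → q ∈ c ∷ cs → height q ≤ₕ height m)
highest c cs = argmax height c cs , top∈ , below
  where
  top∈ : argmax height c cs ∈ c ∷ cs
  top∈ with argmax-sel height c cs
  ... | inj₁ top≡c  = here top≡c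
  ... | inj₂ top∈cs = there top∈cs

  below : ∀ {q} → q ∈ c ∷ cs → height q ≤ₕ height (argmax height c cs)
  below (here refl)  = f[⊥]≤f[argmax] {f = height} c cs
  below (there q∈cs) = All.lookup (f[xs]≤f[argmax] {f = height} c cs) q∈cs

rowAbove-≰ₕ : ∀ {p q} → proj₂ p ℤ.< proj₂ q → ¬ height q ≤ₕ height p
rowAbove-≰ₕ p<q (inj₁ (q≤p , _)) = ℤ.<⇒≱ p<q q≤p
rowAbove-≰ₕ p<q (inj₂ (q≡p , _)) = ℤ.<⇒≢ p<q (sym q≡p)

sameRowRight-≰ₕ : ∀ {p q} → proj₂ q ≡ proj₂ p → proj₁ p ℤ.< proj₁ q → ¬ height q ≤ₕ height p
sameRowRight-≰ₕ q≡p _   (inj₁ (_ , q≢p)) = q≢p q≡p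
sameRowRight-≰ₕ _   p<q (inj₂ (_ , q≤p)) = ℤ.<⇒≱ p<q q≤p

east-≰ₕ : ∀ p → ¬ height (p ⊕ east) ≤ₕ height p
east-≰ₕ (x , y) = sameRowRight-≰ₕ (ℤ.+-identityʳ y) (i<i+1 x)

north-≰ₕ : ∀ p → ¬ height (p ⊕ north) ≤ₕ height p
north-≰ₕ (x , y) = rowAbove-≰ₕ (i<i+1 y)

northWest-≰ₕ : ∀ p → ¬ height (p ⊕ west ⊕ north) ≤ₕ height p
northWest-≰ₕ (x , y) = rowAbove-≰ₕ (subst (λ t → y ℤ.< t ℤ.+ 1ℤ) (sym (ℤ.+-identityʳ y)) (i<i+1 y))

module FromHighestPixel {V : GridGraph} (thin : Thin V) {C : List Point} (cycle : Cycle (AdjacentPixels V) C)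
                        {m : Point} (m∈C : m ∈ C) (pixel-m : IsPixel V m)
                        (highest-m : ∀ {q} → q ∈ C → height q ≤ₕ height m) where

  forced : ∀ {x a b} → x ∈ C → (∀ {z} → z ∈ C → AdjacentPixels V x z → z ≡ a ⊎ z ≡ b) →
           b ∈ C × AdjacentPixels V x b
  forced = Cycle-neighbour-forced AdjacentPixels-sym cycle

  higher-∉ : ∀ {q} → ¬ height q ≤ₕ height m → q ∉ C
  higher-∉ q≰m q∈C = q≰m (highest-m q∈C)

  m-neighbours : ∀ {z} → z ∈ C → AdjacentPixels V m z → z ≡ m ⊕ south ⊎ z ≡ m ⊕ west
  m-neighbours z∈C (_ , _ , inj₁ refl)                = ⊥-elim (higher-∉ (east-≰ₕ m) z∈C)
  m-neighbours z∈C (_ , _ , inj₂ (inj₁ e))            = inj₂ e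
  m-neighbours z∈C (_ , _ , inj₂ (inj₂ (inj₁ refl))) = ⊥-elim (higher-∉ (north-≰ₕ m) z∈C)
  m-neighbours z∈C (_ , _ , inj₂ (inj₂ (inj₂ e)))    = inj₁ e

  w∈C : m ⊕ west ∈ C
  w∈C = proj₁ (forced m∈C m-neighbours)

  pixel-w : IsPixel V (m ⊕ west)
  pixel-w = adjacent-pixel (proj₂ (forced m∈C m-neighbours))

  pixel-s : IsPixel V (m ⊕ south)
  pixel-s = adjacent-pixel (proj₂ (forced m∈C λ z∈C adj → ⊎-swap (m-neighbours z∈C adj)))

  ¬pixel-sw : ¬ IsPixel V (m ⊕ west ⊕ south)
  ¬pixel-sw pixel-sw = thin⇒unsurrounded thin m pixel-m pixel-w pixel-sw pixel-s

  w-neighbours : ∀ {z} → z ∈ C → AdjacentPixels V (m ⊕ west) z → z ≡ m ⊎ z ≡ m ⊕ west ⊕ west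
  w-neighbours z∈C (_ , _ , inj₁ refl)                      = inj₁ (reroute m (west ∷ east ∷ []) [] refl)
  w-neighbours z∈C (_ , _ , inj₂ (inj₁ e))                  = inj₂ e
  w-neighbours z∈C (_ , _ , inj₂ (inj₂ (inj₁ refl)))       = ⊥-elim (higher-∉ (northWest-≰ₕ m) z∈C)
  w-neighbours z∈C (_ , pixel-z , inj₂ (inj₂ (inj₂ refl))) = ⊥-elim (¬pixel-sw pixel-z)

  x∈C : m ⊕ west ⊕ west ∈ C
  x∈C = proj₁ (forced w∈C w-neighbours)

  pixel-x : IsPixel V (m ⊕ west ⊕ west)
  pixel-x = adjacent-pixel (proj₂ (forced w∈C w-neighbours))

  w-exactlyTwoOpposite : ¬ IsPixel V (m ⊕ west ⊕ north) → ExactlyTwoOppositeNeighbours V (m ⊕ west)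
  w-exactlyTwoOpposite ¬pixel-wn =
    exactlyTwoOpposite-horizontal pixel-w pixel-x (IsPixel-reroute m [] (west ∷ east ∷ []) refl pixel-m)
      ¬pixel-wn ¬pixel-sw

  x-exactlyTwoOpposite : IsPixel V (m ⊕ west ⊕ north) → ExactlyTwoOppositeNeighbours V (m ⊕ west ⊕ west)
  x-exactlyTwoOpposite pixel-wn = exactlyTwoOpposite-horizontal pixel-x pixel-xw pixel-xe ¬pixel-xn ¬pixel-xs
    where
    pixel-xe : IsPixel V (m ⊕ west ⊕ west ⊕ east)
    pixel-xe = IsPixel-reroute m (west ∷ []) (west ∷ west ∷ east ∷ []) refl pixel-w

    ¬pixel-xn : ¬ IsPixel V (m ⊕ west ⊕ west ⊕ north)
    ¬pixel-xn pixel-xn =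
      thin⇒unsurrounded thin (m ⊕ west ⊕ north) pixel-wn
        (IsPixel-reroute m (west ∷ west ∷ north ∷ []) (west ∷ north ∷ west ∷ []) refl pixel-xn)
        (IsPixel-reroute m (west ∷ west ∷ []) (west ∷ north ∷ west ∷ south ∷ []) refl pixel-x)
        (IsPixel-reroute m (west ∷ []) (west ∷ north ∷ south ∷ []) refl pixel-w)

    ¬pixel-xs : ¬ IsPixel V (m ⊕ west ⊕ west ⊕ south)
    ¬pixel-xs pixel-xs = ¬pixel-sw (pixel-between
      (IsPixel-reroute m (west ∷ west ∷ south ∷ []) (west ∷ south ∷ west ∷ []) refl pixel-xs)
      (IsPixel-reroute m (south ∷ []) (west ∷ south ∷ east ∷ []) refl pixel-s))

    x-neighbours : ∀ {z} → z ∈ C → AdjacentPixels V (m ⊕ west ⊕ west) z →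
                   z ≡ m ⊕ west ⊎ z ≡ m ⊕ west ⊕ west ⊕ west
    x-neighbours _ adj with horizontal-neighbours ¬pixel-xn ¬pixel-xs adj
    ... | inj₁ z≡xw = inj₂ z≡xw
    ... | inj₂ z≡xe = inj₁ (trans z≡xe (reroute m (west ∷ west ∷ east ∷ []) (west ∷ []) refl))

    pixel-xw : IsPixel V (m ⊕ west ⊕ west ⊕ west)
    pixel-xw = adjacent-pixel (proj₂ (forced x∈C x-neighbours))

  pixelWithExactlyTwoOppositeNeighbours : Σ Point λ p → p ∈ C × ExactlyTwoOppositeNeighbours V p
  pixelWithExactlyTwoOppositeNeighbours with isPixel? (m ⊕ west ⊕ north)
  ... | no ¬pixel-wn = m ⊕ west , w∈C , w-exactlyTwoOpposite ¬pixel-wn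
  ... | yes pixel-wn = m ⊕ west ⊕ west , x∈C , x-exactlyTwoOpposite pixel-wn

PixelCycle⇒Cycle : ∀ {V C} → PixelCycle V C → Cycle (AdjacentPixels V) C
PixelCycle⇒Cycle c = record { atLeast3 = atLeast3 ; unique = distinct ; closed = cyclic }
  where open PixelCycle c

mainTheorem6 : (V : GridGraph) → Polygonal V → Thin V →
               (C : List Point) → PixelCycle V C →
               Σ Point λ p → p ∈ C × ExactlyTwoOppositeNeighbours V p
mainTheorem6 V _ thin [] record { atLeast3 = () }
mainTheorem6 V _ thin (c ∷ cs) pixelCycle with highest c cs
... | _ , m∈C , highest-m =
  FromHighestPixel.pixelWithExactlyTwoOppositeNeighbours thin (PixelCycle⇒Cycle pixelCycle)
    m∈C (All.lookup (PixelCycle.pixels pixelCycle) m∈C) highest-m
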